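{- Let $t$ be a term without explicit substitutions (that is, an ordinary $\lambda$-term). (1) (CbV scrutability) $t$ is VSC-scrutable if and only if $t$ is $\lambda_{\mathsf{Plot}}$-scrutable. (2) (CbV solvability) $t$ is VSC-solvable if and only if $t$ is $\lambda_{\mathsf{Plot}}$-solvable. (3) (With/without ES) For every term $t \in \Lambda_{\mathsf{vsc}}$ (possibly with explicit substitutions), $t$ is CbV scrutable (resp. CbV solvable) if and only if $t^\bullet$ is CbV scrutable (resp. CbV solvable).
   Context: Value substitution calculus (VSC). Terms (the set $\Lambda_{\mathsf{vsc}}$) are $t,u,s ::= v \mid tu \mid t[x{\leftarrow}u]$ and values are $v ::= x \mid \lambda x.t$; $t[x{\leftarrow}u]$ is an explicit substitution (ES), binding $x$ in $t$. Terms are identified up to $\alpha$-renaming; $t\{x{\leftarrow}u\}$ is capture-avoiding (meta-level) substitution. Contexts are terms with exactly one hole $\langle\cdot\rangle$; plugging $C\langle t\rangle$ may capture variables. Substitution contexts: $L ::= \langle\cdot\rangle \mid L[x{\leftarrow}t]$. Root rules: $L\langle\lambda x.t\rangle u \mapsto_{\mathsf m} L\langle t[x{\leftarrow}u]\rangle$ and $t[x{\leftarrow}L\langle v\rangle] \mapsto_{\mathsf e} L\langle t\{x{\leftarrow}v\}\rangle$ with $v$ a value, where (by $\alpha$-renaming) $L$ captures no free variable of $u$, resp. of $t$. Full contexts: $F ::= \langle\cdot\rangle \mid Ft \mid tF \mid \lambda x.F \mid F[x{\leftarrow}t] \mid t[x{\leftarrow}F]$. The reduction $\to_{\mathsf{vsc}}$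 is the closure of $\mapsto_{\mathsf m}\cup\mapsto_{\mathsf e}$ under full contexts. Plotkin's calculus $\lambda_{\mathsf{Plot}}$. Terms are those of the VSC without ES; reduction is the closure under all contexts (without ES) of $(\lambda x.t)v \mapsto t\{x{\leftarrow}v\}$ with $v$ a value (variable or abstraction). Let $\mathsf X$ be VSC or $\lambda_{\mathsf{Plot}}$; below, $t$ in the grammars ranges over terms of $\mathsf X$, and "$\mathsf X$-reduces" means reflexive-transitive closure of the reduction of $\mathsf X$. Head contexts: $H ::= \langle\cdot\rangle \mid \lambda x.H \mid Ht$. Testing contexts: $T ::= \langle\cdot\rangle \mid (\lambda x.T)t \mid Tt$. A term $t$ of $\mathsf X$ is $\mathsf X$-scrutable if there are a testing context $T$ and a value $v$ of $\mathsf X$ such that $T\langle t\rangle$ $\mathsf X$-reduces to $v$. It is $\mathsf X$-solvable if there is a head context $H$ such that $H\langle t\rangle$ $\mathsf X$-reduces to $\mathsf I = \lambda x.x$. "CbV scrutable" / "CbV solvable" mean VSC-scrutable / VSC-solvable. ES expansion: for $t\in\Lambda_{\mathsf{vsc}}$, $t^\bullet$ is the ES-free term defined by $(u[x{\leftarrow}s])^\bullet = (\lambda x.u^\bullet)s^\bullet$, $x^\bullet = x$, $(\lambda x.u)^\bullet=\lambda x.u^\bullet$, $(us)^\bullet = u^\bullet s^\bullet$. -}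

module Defs where

open import Data.Nat using (ℕ; zero; suc; _+_; _≟_)
open import Data.Product using (∃-syntax; _×_)
open import Relation.Binary.Construct.Closure.ReflexiveTransitive using (Star)
open import Relation.Nullary.Decidable using (does)
open import Data.Bool using (if_then_else_)

data Calculus : Set where
  vsc plot : Calculus

private variable
  X : Calculus

infixl 7 _·_
infixl 8 _[_]

-- Terms up to α-renaming, as unscoped de Bruijn terms: the free variables of
-- a term are drawn from the infinite supply ℕ, and a free variable i occurs
-- as var (k + i) under k binders.  Explicit substitutions exist in the VSC
-- only; t [ u ] is t[x←u] and binds index 0 of t.
data Term : Calculus → Set where
  var  : ℕ → Term X
  ƛ    : Term X → Term X
  _·_  : Term X → Term X → Term X
  _[_] : Term vsc → Term vsc → Term vsc

data Value : Term X → Set where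
  var : ∀ x → Value {X} (var x)
  ƛ   : ∀ t → Value {X} (ƛ t)

ext : (ℕ → ℕ) → ℕ → ℕ
ext ρ zero    = zero
ext ρ (suc x) = suc (ρ x)

rename : (ℕ → ℕ) → Term X → Term X
rename ρ (var x)   = var (ρ x)
rename ρ (ƛ t)     = ƛ (rename (ext ρ) t)
rename ρ (t · u)   = rename ρ t · rename ρ u
rename ρ (t [ u ]) = rename (ext ρ) t [ rename ρ u ]

exts : (ℕ → Term X) → ℕ → Term X
exts σ zero    = var zero
exts σ (suc x) = rename suc (σ x)

subst : (ℕ → Term X) → Term X → Term X
subst σ (var x)   = σ x
subst σ (ƛ t)     = ƛ (subst (exts σ) t)
subst σ (t · u)   = subst σ t · subst σ u
subst σ (t [ u ]) = subst (exts σ) t [ subst σ u ]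

-- t ❴ u ❵ is t{x←u}, where x is index 0 of t.
_❴_❵ : Term X → Term X → Term X
_❴_❵ {X} t u = subst σ t
  where
  σ : ℕ → Term X
  σ zero    = u
  σ (suc x) = var x

data SubstCtx : Set where
  ⟨·⟩  : SubstCtx
  _[_] : SubstCtx → Term vsc → SubstCtx

_L⟨_⟩ : SubstCtx → Term vsc → Term vsc
⟨·⟩       L⟨ s ⟩ = s
(L [ t ]) L⟨ s ⟩ = (L L⟨ s ⟩) [ t ]

-- The number of binders of L.  A term that moves inside L is shifted by this
-- amount, which is how L is prevented from capturing its free variables.
∣_∣ : SubstCtx → ℕ
∣ ⟨·⟩ ∣   = 0
∣ L [ t ] ∣ = suc ∣ L ∣

infix 4 _↦_ _⟶_ _⟶*_

-- In rule e, t lies under the binder of its explicit substitution, so it is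
-- shifted by ∣ L ∣ on all its free indices except 0.
data _↦_ : Term X → Term X → Set where
  m  : ∀ L t u →
       (L L⟨ ƛ t ⟩) · u ↦ L L⟨ t [ rename (∣ L ∣ +_) u ] ⟩
  e  : ∀ L t {v} → Value v →
       t [ L L⟨ v ⟩ ] ↦ L L⟨ rename (ext (∣ L ∣ +_)) t ❴ v ❵ ⟩
  βv : ∀ (t : Term plot) {v} → Value v →
       ƛ t · v ↦ t ❴ v ❵

-- Closure of the root rules under all contexts of the calculus.
data _⟶_ : Term X → Term X → Set where
  root : ∀ {t t′ : Term X} → t ↦ t′ → t ⟶ t′
  appˡ : ∀ {t t′ u : Term X} → t ⟶ t′ → t · u ⟶ t′ · u
  appʳ : ∀ {t u u′ : Term X} → u ⟶ u′ → t · u ⟶ t · u′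
  abs  : ∀ {t t′ : Term X} → t ⟶ t′ → ƛ t ⟶ ƛ t′
  esˡ  : ∀ {t t′ u} → t ⟶ t′ → t [ u ] ⟶ t′ [ u ]
  esʳ  : ∀ {t u u′} → u ⟶ u′ → t [ u ] ⟶ t [ u′ ]

_⟶*_ : Term X → Term X → Set
_⟶*_ = Star _⟶_

-- λ⟨ x ⟩ t abstracts the free variable x of t: occurrences of x become
-- the bound index 0, all other free variables stay the same variables (and
-- are shifted under the new binder).
bind : ℕ → ℕ → ℕ
bind x y = if does (x ≟ y) then 0 else suc y

λ⟨_⟩_ : ℕ → Term X → Term X
λ⟨ x ⟩ t = ƛ (rename (bind x) t)

-- Binders of head and testing contexts are named, since plugging may
-- capture any chosen free variable of the plugged term.
data HeadCtx (X : Calculus) : Set where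
  ⟨·⟩ : HeadCtx X
  lam : ℕ → HeadCtx X → HeadCtx X
  _·_ : HeadCtx X → Term X → HeadCtx X

_H⟨_⟩ : HeadCtx X → Term X → Term X
⟨·⟩       H⟨ t ⟩ = t
(lam x H) H⟨ t ⟩ = λ⟨ x ⟩ (H H⟨ t ⟩)
(H · u)   H⟨ t ⟩ = (H H⟨ t ⟩) · u

data TestCtx (X : Calculus) : Set where
  ⟨·⟩  : TestCtx X
  beta : ℕ → TestCtx X → Term X → TestCtx X
  _·_  : TestCtx X → Term X → TestCtx X

_T⟨_⟩ : TestCtx X → Term X → Term X
⟨·⟩          T⟨ t ⟩ = t
(beta x T u) T⟨ t ⟩ = (λ⟨ x ⟩ (T T⟨ t ⟩)) · u
(T · u)      T⟨ t ⟩ = (T T⟨ t ⟩) · u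

I : Term X
I = ƛ (var 0)

Scrutable : ∀ X → Term X → Set
Scrutable X t = ∃[ T ] ∃[ v ] Value v × (T T⟨ t ⟩ ⟶* v)

Solvable : ∀ X → Term X → Set
Solvable X t = ∃[ H ] (H H⟨ t ⟩ ⟶* I)

-- Terms of Plotkin's calculus as VSC terms.
⌈_⌉ : Term plot → Term vsc
⌈ var x ⌉ = var x
⌈ ƛ t ⌉   = ƛ ⌈ t ⌉
⌈ t · u ⌉ = ⌈ t ⌉ · ⌈ u ⌉

_• : Term vsc → Term plot
var x •     = var x
ƛ t •       = ƛ (t •)
(t · u) •   = (t •) · (u •)
(t [ u ]) • = ƛ (t •) · (u •)

{-# OPTIONS --safe #-}

-- Read t[x←u] as the β-redex (λx.t)u.  VSC steps then become steps of
-- Plotkin's calculus extended with two commutation rules (σ₁ and σ₃ below), and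
-- weak call-by-value evaluation is stable under expansion for that extended
-- calculus, so that every term reducing to a value, open terms included,
-- already evaluates to one by βv alone.  For solvability this is used twice: on
-- the plugged term, and on the body of the abstraction it evaluates to, whose
-- reduct is a variable.  Conversely, each βv step from t• lifts to VSC steps
-- from t.

module Submission where

open import Defs
open import Data.Nat using (ℕ; zero; suc; _+_)
open import Data.Nat.Properties using (+-suc)
open import Data.Product using (_×_; _,_; ∃-syntax)
open import Function.Base using (_∘_)
open import Function.Bundles using (_⇔_; mk⇔)
open import Function.Construct.Composition using (_⇔-∘_)
open import Function.Construct.Symmetry using (⇔-sym)
open import Relation.Binary.Construct.Closure.ReflexiveTransitive
  using (Star; ε; _◅_; _◅◅_; gmap)
open import Relation.Binary.PropositionalEquality
  using (_≡_; _≗_; refl; sym; trans; cong; cong₂; subst₂)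
  renaming (subst to transport)

private variable
  X : Calculus

-- Renaming and substitution

ext-cong : ∀ {ρ ρ′} → ρ ≗ ρ′ → ext ρ ≗ ext ρ′
ext-cong eq zero    = refl
ext-cong eq (suc x) = cong suc (eq x)

rename-cong : ∀ {ρ ρ′} → ρ ≗ ρ′ → (t : Term X) → rename ρ t ≡ rename ρ′ t
rename-cong eq (var x)   = cong var (eq x)
rename-cong eq (ƛ t)     = cong ƛ (rename-cong (ext-cong eq) t)
rename-cong eq (t · u)   = cong₂ _·_ (rename-cong eq t) (rename-cong eq u)
rename-cong eq (t [ u ]) = cong₂ _[_] (rename-cong (ext-cong eq) t) (rename-cong eq u)

exts-cong : {σ τ : ℕ → Term X} → σ ≗ τ → exts σ ≗ exts τ
exts-cong eq zero    = refl
exts-cong eq (suc x) = cong (rename suc) (eq x)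

subst-cong : {σ τ : ℕ → Term X} → σ ≗ τ → subst σ ≗ subst τ
subst-cong eq (var x)   = eq x
subst-cong eq (ƛ t)     = cong ƛ (subst-cong (exts-cong eq) t)
subst-cong eq (t · u)   = cong₂ _·_ (subst-cong eq t) (subst-cong eq u)
subst-cong eq (t [ u ]) = cong₂ _[_] (subst-cong (exts-cong eq) t) (subst-cong eq u)

exts-var : {σ : ℕ → Term X} → σ ≗ var → exts σ ≗ var
exts-var eq zero    = refl
exts-var eq (suc x) = cong (rename suc) (eq x)

subst-var : {σ : ℕ → Term X} → σ ≗ var → ∀ t → subst σ t ≡ t
subst-var eq (var x)   = eq x
subst-var eq (ƛ t)     = cong ƛ (subst-var (exts-var eq) t)
subst-var eq (t · u)   = cong₂ _·_ (subst-var eq t) (subst-var eq u)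
subst-var eq (t [ u ]) = cong₂ _[_] (subst-var (exts-var eq) t) (subst-var eq u)

exts-ext : (σ : ℕ → Term X) (ρ : ℕ → ℕ) → exts σ ∘ ext ρ ≗ exts (σ ∘ ρ)
exts-ext σ ρ zero    = refl
exts-ext σ ρ (suc x) = refl

subst-rename : ∀ (σ : ℕ → Term X) ρ t → subst σ (rename ρ t) ≡ subst (σ ∘ ρ) t
subst-rename σ ρ (var x)   = refl
subst-rename σ ρ (ƛ t)     =
  cong ƛ (trans (subst-rename (exts σ) (ext ρ) t) (subst-cong (exts-ext σ ρ) t))
subst-rename σ ρ (t · u)   = cong₂ _·_ (subst-rename σ ρ t) (subst-rename σ ρ u)
subst-rename σ ρ (t [ u ]) = cong₂ _[_]
  (trans (subst-rename (exts σ) (ext ρ) t) (subst-cong (exts-ext σ ρ) t))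
  (subst-rename σ ρ u)

var-ext : (ρ : ℕ → ℕ) → var {X} ∘ ext ρ ≗ exts (var ∘ ρ)
var-ext ρ zero    = refl
var-ext ρ (suc x) = refl

rename≗subst : ∀ ρ → rename {X} ρ ≗ subst (var ∘ ρ)
rename≗subst ρ (var x)   = refl
rename≗subst ρ (ƛ t)     =
  cong ƛ (trans (rename≗subst (ext ρ) t) (subst-cong (var-ext ρ) t))
rename≗subst ρ (t · u)   = cong₂ _·_ (rename≗subst ρ t) (rename≗subst ρ u)
rename≗subst ρ (t [ u ]) = cong₂ _[_]
  (trans (rename≗subst (ext ρ) t) (subst-cong (var-ext ρ) t)) (rename≗subst ρ u)

rename-id : ∀ {ρ} → ρ ≗ (λ x → x) → (t : Term X) → rename ρ t ≡ t
rename-id {ρ = ρ} eq t = trans (rename≗subst ρ t) (subst-var (cong var ∘ eq) t)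

ext-id : ext (λ x → x) ≗ (λ x → x)
ext-id zero    = refl
ext-id (suc x) = refl

rename-rename : ∀ ρ ρ′ (t : Term X) → rename ρ (rename ρ′ t) ≡ rename (ρ ∘ ρ′) t
rename-rename ρ ρ′ t =
  trans (rename≗subst ρ (rename ρ′ t))
    (trans (subst-rename _ ρ′ t) (sym (rename≗subst (ρ ∘ ρ′) t)))

rename-exts : ∀ ρ (σ : ℕ → Term X) → rename (ext ρ) ∘ exts σ ≗ exts (rename ρ ∘ σ)
rename-exts ρ σ zero    = refl
rename-exts ρ σ (suc x) =
  trans (rename-rename (ext ρ) suc (σ x)) (sym (rename-rename suc ρ (σ x)))

rename-subst : ∀ ρ (σ : ℕ → Term X) t →
               rename ρ (subst σ t) ≡ subst (rename ρ ∘ σ) t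
rename-subst ρ σ (var x)   = refl
rename-subst ρ σ (ƛ t)     =
  cong ƛ (trans (rename-subst (ext ρ) (exts σ) t) (subst-cong (rename-exts ρ σ) t))
rename-subst ρ σ (t · u)   = cong₂ _·_ (rename-subst ρ σ t) (rename-subst ρ σ u)
rename-subst ρ σ (t [ u ]) = cong₂ _[_]
  (trans (rename-subst (ext ρ) (exts σ) t) (subst-cong (rename-exts ρ σ) t))
  (rename-subst ρ σ u)

subst-exts-suc : ∀ (σ : ℕ → Term X) t →
                 subst (exts σ) (rename suc t) ≡ rename suc (subst σ t)
subst-exts-suc σ t =
  trans (subst-rename (exts σ) suc t) (sym (rename-subst suc σ t))

-- Stability of `σ₃` under substitution rests on this: there a binder is inserted just outside the
-- one of index 0, and `ext suc` is the matching weakening.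
subst-exts²-ext-suc : ∀ (σ : ℕ → Term X) t →
  subst (exts (exts σ)) (rename (ext suc) t) ≡ rename (ext suc) (subst (exts σ) t)
subst-exts²-ext-suc σ t =
  trans (subst-rename (exts (exts σ)) (ext suc) t)
    (trans (subst-cong pointwise t) (sym (rename-subst (ext suc) (exts σ) t)))
  where
  pointwise : exts (exts σ) ∘ ext suc ≗ rename (ext suc) ∘ exts σ
  pointwise zero    = refl
  pointwise (suc x) =
    trans (rename-rename suc suc (σ x)) (sym (rename-rename (ext suc) suc (σ x)))

exts-subst : (τ σ : ℕ → Term X) → subst (exts τ) ∘ exts σ ≗ exts (subst τ ∘ σ)
exts-subst τ σ zero    = refl
exts-subst τ σ (suc x) = subst-exts-suc τ (σ x)

subst-subst : ∀ (τ σ : ℕ → Term X) t →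
              subst τ (subst σ t) ≡ subst (subst τ ∘ σ) t
subst-subst τ σ (var x)   = refl
subst-subst τ σ (ƛ t)     =
  cong ƛ (trans (subst-subst (exts τ) (exts σ) t) (subst-cong (exts-subst τ σ) t))
subst-subst τ σ (t · u)   = cong₂ _·_ (subst-subst τ σ t) (subst-subst τ σ u)
subst-subst τ σ (t [ u ]) = cong₂ _[_]
  (trans (subst-subst (exts τ) (exts σ) t) (subst-cong (exts-subst τ σ) t))
  (subst-subst τ σ u)

-- The substitution inside `_❴_❵` is local to that definition; this top-level copy agrees with it
-- pointwise and can be named in lemmas.
single : Term X → ℕ → Term X
single u zero    = u
single u (suc x) = var x

❴❵-single : ∀ (t u : Term X) → t ❴ u ❵ ≡ subst (single u) t
❴❵-single t u = subst-cong (λ { zero → refl ; (suc x) → refl }) t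

rename-suc-❴❵ : ∀ (t u : Term X) → rename suc t ❴ u ❵ ≡ t
rename-suc-❴❵ t u =
  trans (❴❵-single (rename suc t) u)
    (trans (subst-rename (single u) suc t) (subst-var (λ _ → refl) t))

subst-❴❵ : ∀ (σ : ℕ → Term X) t u →
           subst σ (t ❴ u ❵) ≡ subst (exts σ) t ❴ subst σ u ❵
subst-❴❵ σ t u =
  trans (cong (subst σ) (❴❵-single t u))
    (trans (subst-subst σ (single u) t)
      (trans (subst-cong pointwise t)
        (sym (trans (❴❵-single (subst (exts σ) t) (subst σ u))
               (subst-subst (single (subst σ u)) (exts σ) t)))))
  where
  pointwise : subst σ ∘ single u ≗ subst (single (subst σ u)) ∘ exts σ
  pointwise zero    = refl
  pointwise (suc x) = sym (trans (subst-rename (single (subst σ u)) suc (σ x))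
                                 (subst-var (λ _ → refl) (σ x)))

-- Plotkin's calculus with commutation rules

infix 4 _↝_ _⇒_ _⇓_

-- `σ₁` and `σ₃` are the permutation rules of the shuffling calculus, with `σ₃` restricted to an
-- abstraction on the left, the shape that explicit substitutions expand to. Each moves one frame of
-- a substitution context outwards.
data _↝_ : Term plot → Term plot → Set where
  βv : ∀ t {v} → Value v → ƛ t · v ↝ t ❴ v ❵
  σ₁ : ∀ t p u → ƛ t · p · u ↝ ƛ (t · rename suc u) · p
  σ₃ : ∀ t r p → ƛ t · (ƛ r · p) ↝ ƛ (ƛ (rename (ext suc) t) · r) · p

-- Root steps come first and the congruence last (the inverse of Howe's
-- closure), so that expansion of evaluation is an induction on evaluation.
data _⇒_ : Term plot → Term plot → Set where
  step : ∀ {t t′ u} → t ↝ t′ → t′ ⇒ u → t ⇒ u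
  var  : ∀ x → var x ⇒ var x
  ƛ    : ∀ {t t′} → t ⇒ t′ → ƛ t ⇒ ƛ t′
  _·_  : ∀ {t t′ u u′} → t ⇒ t′ → u ⇒ u′ → t · u ⇒ t′ · u′

-- Variables count as values, so evaluation also applies to open terms, in particular to bodies of
-- abstractions.
data _⇓_ : Term plot → Term plot → Set where
  value : ∀ {v} → Value v → v ⇓ v
  app   : ∀ {t u r v w} → t ⇓ ƛ r → u ⇓ v → r ❴ v ❵ ⇓ w → t · u ⇓ w

⇓-Value : ∀ {t w} → t ⇓ w → Value w
⇓-Value (value v)   = v
⇓-Value (app _ _ d) = ⇓-Value d

⇓-sound : ∀ {t w} → t ⇓ w → t ⟶* w
⇓-sound (value _)      = ε
⇓-sound (app {u = u} {r = r} d₁ d₂ d₃) =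
  gmap (_· u) appˡ (⇓-sound d₁) ◅◅
  gmap (ƛ r ·_) appʳ (⇓-sound d₂) ◅◅
  root (βv r (⇓-Value d₂)) ◅ ⇓-sound d₃

⇒-refl : ∀ t → t ⇒ t
⇒-refl (var x) = var x
⇒-refl (ƛ t)   = ƛ (⇒-refl t)
⇒-refl (t · u) = ⇒-refl t · ⇒-refl u

⇒-reflexive : ∀ {t u} → t ≡ u → t ⇒ u
⇒-reflexive {t} refl = ⇒-refl t

-- Stability of rewriting under value substitutions

rename-Value : ∀ ρ {v : Term X} → Value v → Value (rename ρ v)
rename-Value ρ (var x) = var (ρ x)
rename-Value ρ (ƛ t)   = ƛ (rename (ext ρ) t)

subst-Value : ∀ {σ : ℕ → Term X} {v} → (∀ x → Value (σ x)) → Value v →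
              Value (subst σ v)
subst-Value         σ-val (var x) = σ-val x
subst-Value {σ = σ} σ-val (ƛ t)   = ƛ (subst (exts σ) t)

exts-Value : ∀ {σ : ℕ → Term X} → (∀ x → Value (σ x)) → ∀ x → Value (exts σ x)
exts-Value σ-val zero    = var zero
exts-Value σ-val (suc x) = rename-Value suc (σ-val x)

↝-subst : ∀ {σ t u} → (∀ x → Value (σ x)) → t ↝ u → subst σ t ↝ subst σ u
↝-subst {σ} σ-val (βv t {v} val)
  rewrite subst-❴❵ σ t v = βv (subst (exts σ) t) (subst-Value σ-val val)
↝-subst {σ} σ-val (σ₁ t p u)
  rewrite subst-exts-suc σ u = σ₁ (subst (exts σ) t) (subst σ p) (subst σ u)
↝-subst {σ} σ-val (σ₃ t r p)
  rewrite subst-exts²-ext-suc σ t =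
    σ₃ (subst (exts σ) t) (subst (exts σ) r) (subst σ p)

↝-rename : ∀ ρ {t u} → t ↝ u → rename ρ t ↝ rename ρ u
↝-rename ρ {t} {u} s =
  subst₂ _↝_ (sym (rename≗subst ρ t)) (sym (rename≗subst ρ u))
    (↝-subst (λ x → var (ρ x)) s)

⇒-rename : ∀ ρ {t u} → t ⇒ u → rename ρ t ⇒ rename ρ u
⇒-rename ρ (step s r) = step (↝-rename ρ s) (⇒-rename ρ r)
⇒-rename ρ (var x)    = var (ρ x)
⇒-rename ρ (ƛ r)      = ƛ (⇒-rename (ext ρ) r)
⇒-rename ρ (r · r′)   = ⇒-rename ρ r · ⇒-rename ρ r′

⇒-exts : ∀ {σ τ} → (∀ x → σ x ⇒ τ x) → ∀ x → exts σ x ⇒ exts τ x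
⇒-exts σ⇒τ zero    = var zero
⇒-exts σ⇒τ (suc x) = ⇒-rename suc (σ⇒τ x)

-- Root steps come first and are replayed under `σ`, which is why values are required there; `τ`
-- enters only at the variable leaves.
⇒-subst : ∀ {σ τ t u} → (∀ x → Value (σ x)) → (∀ x → σ x ⇒ τ x) → t ⇒ u →
          subst σ t ⇒ subst τ u
⇒-subst σ-val σ⇒τ (step s r) = step (↝-subst σ-val s) (⇒-subst σ-val σ⇒τ r)
⇒-subst σ-val σ⇒τ (var x)    = σ⇒τ x
⇒-subst σ-val σ⇒τ (ƛ r)      = ƛ (⇒-subst (exts-Value σ-val) (⇒-exts σ⇒τ) r)
⇒-subst σ-val σ⇒τ (r · r′)   = ⇒-subst σ-val σ⇒τ r · ⇒-subst σ-val σ⇒τ r′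

⇒-❴❵ : ∀ {t t′ v v′} → Value v → t ⇒ t′ → v ⇒ v′ → t ❴ v ❵ ⇒ t′ ❴ v′ ❵
⇒-❴❵ {t} {t′} {v} {v′} val r s =
  subst₂ _⇒_ (sym (❴❵-single t v)) (sym (❴❵-single t′ v′))
    (⇒-subst (λ { zero → val ; (suc x) → var x })
             (λ { zero → s ; (suc x) → var x }) r)

-- Stability of evaluation under expansion

⇓-↝-expand : ∀ {t u w} → t ↝ u → u ⇓ w → t ⇓ w
⇓-↝-expand (βv t val) d = app (value (ƛ t)) (value val) d
-- Inverting the evaluation of the reduct gives the premises for the redex in another arrangement,
-- up to the shifts undone below.
⇓-↝-expand (σ₁ t p u) (app {v = v} (value _) dp (app dt du d)) =
  app (app (value (ƛ t)) dp dt) (transport (_⇓ _) unshift du) d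
  where
  unshift : subst _ (rename suc u) ≡ u
  -- The substitution local to `_❴_❵` takes the body as a parameter, so instances for different
  -- bodies agree only pointwise; `subst-cong` bridges them.
  unshift = trans (sym (subst-cong (λ { zero → refl ; (suc x) → refl }) (rename suc u)))
                  (rename-suc-❴❵ u v)
⇓-↝-expand (σ₃ t r p) (app {v = v} (value _) dp (app {v = v′} (value _) dr d)) =
  app (value (ƛ t)) (app (value (ƛ r)) dp (transport (_⇓ v′) same dr))
    (transport (λ s → s ❴ v′ ❵ ⇓ _) unshift d)
  where
  same : subst _ r ≡ r ❴ v ❵
  same = subst-cong (λ { zero → refl ; (suc x) → refl }) r
  unshift : subst (exts _) (rename (ext suc) t) ≡ t
  -- The shifted `t` avoids index 1, and `exts` leaves index 0 alone, so the substitution merely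
  -- undoes the shift.
  unshift = trans (subst-rename _ (ext suc) t)
                  (subst-var (λ { zero → refl ; (suc x) → refl }) t)

⇒-ƛ-inversion : ∀ {w r′} → Value w → w ⇒ ƛ r′ → ∃[ r ] w ≡ ƛ r × r ⇒ r′
⇒-ƛ-inversion (var x) (step () _)
⇒-ƛ-inversion (ƛ t)   (ƛ r) = t , refl , r

-- Lexicographic induction on the evaluation, then on the rewriting. For an application, the first
-- two premises give an abstraction and a value that still rewrite to the given ones, so the
-- contracta are related by `⇒-❴❵` and the third premise is a smaller evaluation.
⇓-⇒-expand : ∀ {t u w′} → t ⇒ u → u ⇓ w′ → ∃[ w ] t ⇓ w × w ⇒ w′
⇓-⇒-expand (step s r) d =
  let w , d′ , r′ = ⇓-⇒-expand r d in w , ⇓-↝-expand s d′ , r′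
⇓-⇒-expand (var x)    (value val) = var x , value (var x) , var x
⇓-⇒-expand (ƛ {t} r)  (value val) = ƛ t , value (ƛ t) , ƛ r
⇓-⇒-expand (r₁ · r₂)  (app d₁ d₂ d₃)
  with ⇓-⇒-expand r₁ d₁ | ⇓-⇒-expand r₂ d₂
... | _ , e₁ , s₁ | v , e₂ , s₂
  with ⇒-ƛ-inversion (⇓-Value e₁) s₁
... | _ , refl , s
  with ⇓-⇒-expand (⇒-❴❵ (⇓-Value e₂) s s₂) d₃
... | w , e₃ , s₃ = w , app e₁ e₂ e₃ , s₃

⇓-⇒*-expand : ∀ {t u w′} → Star _⇒_ t u → u ⇓ w′ → ∃[ w ] t ⇓ w × Star _⇒_ w w′
⇓-⇒*-expand ε        d = _ , d , ε
⇓-⇒*-expand (r ◅ rs) d with ⇓-⇒*-expand rs d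
... | _ , d′ , ss with ⇓-⇒-expand r d′
... | w , d″ , s = w , d″ , s ◅ ss

⇒*-var-inversion : ∀ {w x} → Value w → Star _⇒_ w (var x) → w ≡ var x
⇒*-var-inversion _       ε             = refl
⇒*-var-inversion (var x) (var .x ◅ rs) = ⇒*-var-inversion (var x) rs
⇒*-var-inversion (ƛ t)   (ƛ _ ◅ rs) with ⇒*-var-inversion (ƛ _) rs
... | ()

⇒*-ƛ-inversion : ∀ {w r′} → Value w → Star _⇒_ w (ƛ r′) →
                 ∃[ r ] w ≡ ƛ r × Star _⇒_ r r′
⇒*-ƛ-inversion _       ε             = _ , refl , ε
⇒*-ƛ-inversion (var x) (var .x ◅ rs) = ⇒*-ƛ-inversion (var x) rs
⇒*-ƛ-inversion (ƛ t)   (ƛ s ◅ rs) with ⇒*-ƛ-inversion (ƛ _) rs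
... | r , refl , ss = t , refl , s ◅ ss

-- The value reached may differ from `v`; scrutability asks only that there is one.
⇒*-value : ∀ {t v} → Value v → Star _⇒_ t v → ∃[ w ] Value w × t ⟶* w
⇒*-value val rs = let w , d , _ = ⇓-⇒*-expand rs (value val) in
  w , ⇓-Value d , ⇓-sound d

-- Weak evaluation stops at some `ƛ r` with `r` rewriting to `var 0`. A second evaluation, of the
-- open body `r`, reaches a value that rewrites to `var 0`, and among values only `var 0` does.
⇒*-I : ∀ {t} → Star _⇒_ t I → t ⟶* I
⇒*-I rs with ⇓-⇒*-expand rs (value (ƛ (var 0)))
... | w , d , ss with ⇒*-ƛ-inversion (⇓-Value d) ss
... | r , refl , ss′ with ⇓-⇒*-expand ss′ (value (var 0))
... | w′ , d′ , ss″ with ⇒*-var-inversion (⇓-Value d′) ss″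
... | refl = ⇓-sound d ◅◅ gmap ƛ abs (⇓-sound d′)

-- ES expansion

•-rename : ∀ ρ t → rename ρ t • ≡ rename ρ (t •)
•-rename ρ (var x)   = refl
•-rename ρ (ƛ t)     = cong ƛ (•-rename (ext ρ) t)
•-rename ρ (t · u)   = cong₂ _·_ (•-rename ρ t) (•-rename ρ u)
•-rename ρ (t [ u ]) = cong₂ (λ t u → ƛ t · u) (•-rename (ext ρ) t) (•-rename ρ u)

•-exts : ∀ {σ τ} → (∀ x → σ x • ≡ τ x) → ∀ x → exts σ x • ≡ exts τ x
•-exts eq zero    = refl
•-exts {σ} eq (suc x) = trans (•-rename suc (σ x)) (cong (rename suc) (eq x))

•-subst : ∀ {σ τ} → (∀ x → σ x • ≡ τ x) → ∀ t → subst σ t • ≡ subst τ (t •)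
•-subst eq (var x)   = eq x
•-subst eq (ƛ t)     = cong ƛ (•-subst (•-exts eq) t)
•-subst eq (t · u)   = cong₂ _·_ (•-subst eq t) (•-subst eq u)
•-subst eq (t [ u ]) =
  cong₂ (λ t u → ƛ t · u) (•-subst (•-exts eq) t) (•-subst eq u)

•-❴❵ : ∀ t u → (t ❴ u ❵) • ≡ (t •) ❴ u • ❵
•-❴❵ t u = •-subst (λ { zero → refl ; (suc x) → refl }) t

•-Value : ∀ {v} → Value v → Value (v •)
•-Value (var x) = var x
•-Value (ƛ t)   = ƛ (t •)

•-Value⁻¹ : ∀ t → Value (t •) → Value t
•-Value⁻¹ (var x) _ = var x
•-Value⁻¹ (ƛ t)   _ = ƛ t

⌈⌉-• : ∀ t → ⌈ t ⌉ • ≡ t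
⌈⌉-• (var x) = refl
⌈⌉-• (ƛ t)   = cong ƛ (⌈⌉-• t)
⌈⌉-• (t · u) = cong₂ _·_ (⌈⌉-• t) (⌈⌉-• u)

-- Induction on `L`: each explicit substitution is crossed by one `σ₁`, and for empty `L` both sides
-- have the same expansion.
•-m : ∀ L t u → ((L L⟨ ƛ t ⟩) · u) • ⇒ (L L⟨ t [ rename (∣ L ∣ +_) u ] ⟩) •
•-m ⟨·⟩       t u =
  ⇒-reflexive (cong (λ u → (ƛ t · u) •) (sym (rename-id (λ _ → refl) u)))
•-m (L [ p ]) t u = step (σ₁ _ _ _) (ƛ body · ⇒-refl (p •))
  where
  shift : rename (∣ L ∣ +_) (rename suc u) ≡ rename (suc ∣ L ∣ +_) u
  shift = trans (rename-rename _ suc u) (rename-cong (+-suc ∣ L ∣) u)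
  body : (L L⟨ ƛ t ⟩) • · rename suc (u •) ⇒
         (L L⟨ t [ rename (suc ∣ L ∣ +_) u ] ⟩) •
  body = subst₂ (λ u u′ → (L L⟨ ƛ t ⟩) • · u ⇒ (L L⟨ t [ u′ ] ⟩) •)
           (•-rename suc u) shift (•-m L t (rename suc u))

-- Each explicit substitution of `L` is crossed by one `σ₃`; once the value is exposed, `βv`
-- performs the substitution.
•-e : ∀ L t {v} → Value v →
      (t [ L L⟨ v ⟩ ]) • ⇒ (L L⟨ rename (ext (∣ L ∣ +_)) t ❴ v ❵ ⟩) •
•-e ⟨·⟩       t {v} val = step (βv (t •) (•-Value val))
  (⇒-reflexive (sym (trans (cong (λ t → (t ❴ v ❵) •) (rename-id ext-id t))
                           (•-❴❵ t v))))
•-e (L [ p ]) t {v} val = step (σ₃ _ _ _) (ƛ body · ⇒-refl (p •))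
  where
  pointwise : ext (∣ L ∣ +_) ∘ ext suc ≗ ext (suc ∣ L ∣ +_)
  pointwise zero    = refl
  pointwise (suc x) = cong suc (+-suc ∣ L ∣ x)
  shift : rename (ext (∣ L ∣ +_)) (rename (ext suc) t) ≡
          rename (ext (suc ∣ L ∣ +_)) t
  shift = trans (rename-rename _ (ext suc) t) (rename-cong pointwise t)
  body : ƛ (rename (ext suc) (t •)) · (L L⟨ v ⟩) • ⇒
         (L L⟨ rename (ext (suc ∣ L ∣ +_)) t ❴ v ❵ ⟩) •
  body = subst₂ (λ t t′ → ƛ t · (L L⟨ v ⟩) • ⇒ (L L⟨ t′ ❴ v ❵ ⟩) •)
           (•-rename (ext suc) t) shift (•-e L (rename (ext suc) t) val)

•-⟶ : ∀ {t u} → t ⟶ u → t • ⇒ u •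
•-⟶ (root (m L t u))   = •-m L t u
•-⟶ (root (e L t val)) = •-e L t val
•-⟶ (appˡ s)           = •-⟶ s · ⇒-refl _
•-⟶ (appʳ s)           = ⇒-refl _ · •-⟶ s
•-⟶ (abs s)            = ƛ (•-⟶ s)
•-⟶ (esˡ s)            = ƛ (•-⟶ s) · ⇒-refl _
•-⟶ (esʳ s)            = ⇒-refl _ · •-⟶ s

-- Lifting Plotkin steps to the VSC

es-⟶ : ∀ t {v : Term vsc} → Value v → t [ v ] ⟶ t ❴ v ❵
es-⟶ t {v} val =
  transport (λ s → t [ v ] ⟶ s ❴ v ❵) (rename-id ext-id t) (root (e ⟨·⟩ t val))

app-⟶ : ∀ (t u : Term vsc) → ƛ t · u ⟶ t [ u ]
app-⟶ t u =
  transport (λ s → ƛ t · u ⟶ t [ s ]) (rename-id (λ _ → refl) u) (root (m ⟨·⟩ t u))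

-- Quantifying over every `s` that expands to `p` lets steps be chained and covers terms with
-- explicit substitutions. The contracted redex comes either from an applied abstraction, lifted by
-- `m` then `e`, or from an explicit substitution, lifted by `e` alone.
•-⟶-lift : ∀ {p q} → p ⟶ q → ∀ s → s • ≡ p → ∃[ s′ ] s ⟶* s′ × s′ • ≡ q
•-⟶-lift (root (βv _ val)) (ƛ t · u) refl =
  t ❴ u ❵ , app-⟶ t u ◅ es-⟶ t (•-Value⁻¹ u val) ◅ ε , •-❴❵ t u
•-⟶-lift (root (βv _ val)) (t [ u ]) refl =
  t ❴ u ❵ , es-⟶ t (•-Value⁻¹ u val) ◅ ε , •-❴❵ t u
•-⟶-lift (appˡ p⟶q) (t · u) refl =
  let t′ , ss , eq = •-⟶-lift p⟶q t refl in
  t′ · u , gmap (_· u) appˡ ss , cong (_· u •) eq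
-- The left part is the abstraction made by expansion; no root rule applies to it, so the step lies
-- in its body.
•-⟶-lift (appˡ (abs p⟶q)) (t [ u ]) refl =
  let t′ , ss , eq = •-⟶-lift p⟶q t refl in
  t′ [ u ] , gmap (_[ u ]) esˡ ss , cong (λ t → ƛ t · u •) eq
•-⟶-lift (appʳ p⟶q) (t · u) refl =
  let u′ , ss , eq = •-⟶-lift p⟶q u refl in
  t · u′ , gmap (t ·_) appʳ ss , cong (t • ·_) eq
•-⟶-lift (appʳ p⟶q) (t [ u ]) refl =
  let u′ , ss , eq = •-⟶-lift p⟶q u refl in
  t [ u′ ] , gmap (t [_]) esʳ ss , cong (ƛ (t •) ·_) eq
•-⟶-lift (abs p⟶q) (ƛ t) refl =
  let t′ , ss , eq = •-⟶-lift p⟶q t refl in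
  ƛ t′ , gmap ƛ abs ss , cong ƛ eq

•-⟶*-lift : ∀ {p q} → p ⟶* q → ∀ s → s • ≡ p → ∃[ s′ ] s ⟶* s′ × s′ • ≡ q
•-⟶*-lift ε        s eq = s , ε , eq
•-⟶*-lift (r ◅ rs) s eq =
  let s′ , ss , eq′ = •-⟶-lift r s eq
      s″ , ss′ , eq″ = •-⟶*-lift rs s′ eq′
  in s″ , ss ◅◅ ss′ , eq″

•-I⁻¹ : ∀ t → t • ≡ I → t ≡ I
•-I⁻¹ (ƛ (var 0)) refl = refl

-- Contexts

_T• : TestCtx vsc → TestCtx plot
⟨·⟩          T• = ⟨·⟩
(beta x T u) T• = beta x (T T•) (u •)
(T · u)      T• = (T T•) · (u •)

⌈_⌉T : TestCtx plot → TestCtx vsc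
⌈ ⟨·⟩ ⌉T        = ⟨·⟩
⌈ beta x T u ⌉T = beta x ⌈ T ⌉T ⌈ u ⌉
⌈ T · u ⌉T      = ⌈ T ⌉T · ⌈ u ⌉

_H• : HeadCtx vsc → HeadCtx plot
⟨·⟩       H• = ⟨·⟩
(lam x H) H• = lam x (H H•)
(H · u)   H• = (H H•) · (u •)

⌈_⌉H : HeadCtx plot → HeadCtx vsc
⌈ ⟨·⟩ ⌉H     = ⟨·⟩
⌈ lam x H ⌉H = lam x ⌈ H ⌉H
⌈ H · u ⌉H   = ⌈ H ⌉H · ⌈ u ⌉

•-λ⟨⟩ : ∀ x {t p} → t • ≡ p → (λ⟨ x ⟩ t) • ≡ λ⟨ x ⟩ p
•-λ⟨⟩ x {t} refl = cong ƛ (•-rename (bind x) t)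

T•-plug : ∀ T t → (T T⟨ t ⟩) • ≡ (T T•) T⟨ t • ⟩
T•-plug ⟨·⟩          t = refl
T•-plug (beta x T u) t = cong (_· u •) (•-λ⟨⟩ x (T•-plug T t))
T•-plug (T · u)      t = cong (_· u •) (T•-plug T t)

-- `t` keeps its explicit substitutions, so the two sides meet only after expansion, which is the
-- form that `•-⟶*-lift` takes as input.
⌈⌉T-plug : ∀ T t → (⌈ T ⌉T T⟨ t ⟩) • ≡ T T⟨ t • ⟩
⌈⌉T-plug ⟨·⟩          t = refl
⌈⌉T-plug (beta x T u) t = cong₂ _·_ (•-λ⟨⟩ x (⌈⌉T-plug T t)) (⌈⌉-• u)
⌈⌉T-plug (T · u)      t = cong₂ _·_ (⌈⌉T-plug T t) (⌈⌉-• u)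

H•-plug : ∀ H t → (H H⟨ t ⟩) • ≡ (H H•) H⟨ t • ⟩
H•-plug ⟨·⟩       t = refl
H•-plug (lam x H) t = •-λ⟨⟩ x (H•-plug H t)
H•-plug (H · u)   t = cong (_· u •) (H•-plug H t)

⌈⌉H-plug : ∀ H t → (⌈ H ⌉H H⟨ t ⟩) • ≡ H H⟨ t • ⟩
⌈⌉H-plug ⟨·⟩       t = refl
⌈⌉H-plug (lam x H) t = •-λ⟨⟩ x (⌈⌉H-plug H t)
⌈⌉H-plug (H · u)   t = cong₂ _·_ (⌈⌉H-plug H t) (⌈⌉-• u)

-- Transfer of scrutability and solvability

•-Scrutable : ∀ t → Scrutable vsc t ⇔ Scrutable plot (t •)
•-Scrutable t = mk⇔ to from
  where
  to : Scrutable vsc t → Scrutable plot (t •)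
  to (T , v , val , rs) =
    let w , val′ , ss = ⇒*-value (•-Value val) (gmap _• •-⟶ rs) in
    T T• , w , val′ , transport (_⟶* w) (T•-plug T t) ss
  from : Scrutable plot (t •) → Scrutable vsc t
  from (T , v , val , rs) =
    let s , ss , eq = •-⟶*-lift rs (⌈ T ⌉T T⟨ t ⟩) (⌈⌉T-plug T t) in
    ⌈ T ⌉T , s , •-Value⁻¹ s (transport Value (sym eq) val) , ss

•-Solvable : ∀ t → Solvable vsc t ⇔ Solvable plot (t •)
•-Solvable t = mk⇔ to from
  where
  to : Solvable vsc t → Solvable plot (t •)
  to (H , rs) =
    H H• , transport (_⟶* I) (H•-plug H t) (⇒*-I (gmap _• •-⟶ rs))
  from : Solvable plot (t •) → Solvable vsc t
  from (H , rs) =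
    let s , ss , eq = •-⟶*-lift rs (⌈ H ⌉H H⟨ t ⟩) (⌈⌉H-plug H t) in
    -- Only `I` expands to `I`, so the lifted reduction ends exactly there.
    ⌈ H ⌉H , transport ((⌈ H ⌉H H⟨ t ⟩) ⟶*_) (•-I⁻¹ s eq) ss

-- The case of an ES-free term, where expansion undoes the embedding.
⌈⌉-Scrutable : ∀ t → Scrutable vsc ⌈ t ⌉ ⇔ Scrutable plot t
⌈⌉-Scrutable t =
  transport (λ s → Scrutable vsc ⌈ t ⌉ ⇔ Scrutable plot s) (⌈⌉-• t) (•-Scrutable ⌈ t ⌉)

⌈⌉-Solvable : ∀ t → Solvable vsc ⌈ t ⌉ ⇔ Solvable plot t
⌈⌉-Solvable t =
  transport (λ s → Solvable vsc ⌈ t ⌉ ⇔ Solvable plot s) (⌈⌉-• t) (•-Solvable ⌈ t ⌉)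

theorem5p4 : (∀ (t : Term plot) → Scrutable vsc ⌈ t ⌉ ⇔ Scrutable plot t)
    × (∀ (t : Term plot) → Solvable vsc ⌈ t ⌉ ⇔ Solvable plot t)
    × (∀ (t : Term vsc) →
    (Scrutable vsc t ⇔ Scrutable vsc ⌈ t • ⌉)
    × (Solvable vsc t ⇔ Solvable vsc ⌈ t • ⌉))
theorem5p4 =
  ⌈⌉-Scrutable , ⌈⌉-Solvable , λ t →
    -- Both sides are equivalent to Plotkin scrutability of `t •`.
    (⇔-sym (⌈⌉-Scrutable (t •)) ⇔-∘ •-Scrutable t) ,
    (⇔-sym (⌈⌉-Solvable (t •)) ⇔-∘ •-Solvable t)
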